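{- Let $X$ be a binary matrix. The rectangle cover graph $\mathcal{G}(X)$ contains a hole of length $5$ if and only if $X$ has at least one of $D_4$, $H_3$, $H_3^\top$ or $K_5$ as a submatrix (up to permutation of the rows and columns of the submatrix).
   Context: For a binary matrix $X=(x_{i,j})$, $\operatorname{supp}(X)=\{(i,j):x_{i,j}=1\}$; a rectangle of $X$ is a set $I\times J\subseteq\operatorname{supp}(X)$ with $I$ a set of rows and $J$ a set of columns. The rectangle cover graph $\mathcal{G}(X)$ has vertex set $\operatorname{supp}(X)$, two distinct vertices being adjacent iff they lie in a common rectangle of $X$. A hole of length $5$ is an induced chordless cycle on $5$ vertices. A submatrix is obtained by deleting some rows and columns. The matrices are: $D_4=\begin{bmatrix}0&1&1&0\\1&1&1&0\\1&1&1&1\\0&0&1&1\end{bmatrix}$, $H_3=\begin{bmatrix}1&1&1&0\\1&0&1&1\\1&1&0&1\end{bmatrix}$, and $K_5$ is the $5\times5$ matrix with $(K_5)_{i,j}=1$ iff $(j-i)\bmod 5\in\{0,1,2\}$. -}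

module Defs where

open import Data.Bool using (Bool; true; false)
open import Data.Nat using (ℕ; _%_; _+_)
open import Data.Fin using (Fin; toℕ)
open import Data.Fin.Subset using (Subset; _∈_)
open import Data.Vec using (Vec; []; _∷_; lookup)
open import Data.Product using (Σ; _×_; _,_; ∃; ∃-syntax)
open import Data.Sum using (_⊎_)
open import Relation.Nullary using (¬_)
open import Relation.Binary.PropositionalEquality using (_≡_; _≢_)
open import Function.Definitions using (Injective)
open import Function.Bundles using (_⇔_)

BinMatrix : ℕ → ℕ → Set
BinMatrix m n = Fin m → Fin n → Bool

fromRows : ∀ {m n} → Vec (Vec Bool n) m → BinMatrix m n
fromRows t i j = lookup (lookup t i) j

transpose : ∀ {m n} → BinMatrix m n → BinMatrix n m
transpose X j i = X i j

Pos : ℕ → ℕ → Set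
Pos m n = Fin m × Fin n

InSupp : ∀ {m n} → BinMatrix m n → Pos m n → Set
InSupp X (i , j) = X i j ≡ true

IsRectangle : ∀ {m n} → BinMatrix m n → Subset m → Subset n → Set
IsRectangle X I J = ∀ i j → i ∈ I → j ∈ J → X i j ≡ true

InRect : ∀ {m n} → Subset m → Subset n → Pos m n → Set
InRect I J (i , j) = i ∈ I × j ∈ J

-- Adjacency in the rectangle cover graph G(X) (on vertices of supp(X)):
-- distinct and lying in a common rectangle of X.
Adjacent : ∀ {m n} → BinMatrix m n → Pos m n → Pos m n → Set
Adjacent {m} {n} X p q =
  p ≢ q × ∃[ I ] ∃[ J ] (IsRectangle X I J × InRect {m} {n} I J p × InRect I J q)

Consecutive5 : Fin 5 → Fin 5 → Set
Consecutive5 a b = (toℕ a + 1) % 5 ≡ toℕ b ⊎ (toℕ b + 1) % 5 ≡ toℕ a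

HasHole5 : ∀ {m n} → BinMatrix m n → Set
HasHole5 {m} {n} X =
  Σ (Fin 5 → Pos m n) λ v →
    Injective _≡_ _≡_ v
    × (∀ a → InSupp X (v a))
    × (∀ a b → a ≢ b → (Adjacent X (v a) (v b) ⇔ Consecutive5 a b))

-- X has M as a submatrix up to permutation of the rows and columns of the
-- submatrix: injective choices of rows r and columns c with X (r i) (c j) = M i j.
HasSubmatrix : ∀ {m n p q} → BinMatrix m n → BinMatrix p q → Set
HasSubmatrix {m} {n} {p} {q} X M =
  Σ (Fin p → Fin m) λ r → Σ (Fin q → Fin n) λ c →
    Injective _≡_ _≡_ r × Injective _≡_ _≡_ c
    × (∀ i j → X (r i) (c j) ≡ M i j)

D4 : BinMatrix 4 4
D4 = fromRows
  ( (false ∷ true  ∷ true  ∷ false ∷ [])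
  ∷ (true  ∷ true  ∷ true  ∷ false ∷ [])
  ∷ (true  ∷ true  ∷ true  ∷ true  ∷ [])
  ∷ (false ∷ false ∷ true  ∷ true  ∷ [])
  ∷ [])

H3 : BinMatrix 3 4
H3 = fromRows
  ( (true ∷ true  ∷ true  ∷ false ∷ [])
  ∷ (true ∷ false ∷ true  ∷ true  ∷ [])
  ∷ (true ∷ true  ∷ false ∷ true  ∷ [])
  ∷ [])

-- (K5)_{i,j} = 1 iff (j - i) mod 5 ∈ {0,1,2}
K5 : BinMatrix 5 5
K5 = fromRows
  ( (true  ∷ true  ∷ true  ∷ false ∷ false ∷ [])
  ∷ (false ∷ true  ∷ true  ∷ true  ∷ false ∷ [])
  ∷ (false ∷ false ∷ true  ∷ true  ∷ true  ∷ [])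
  ∷ (true  ∷ false ∷ false ∷ true  ∷ true  ∷ [])
  ∷ (true  ∷ true  ∷ false ∷ false ∷ true  ∷ [])
  ∷ [])

-- Two positions (i , j) and (i′ , j′) of the support lie in a common rectangle
-- iff both crossing entries (i , j′) and (i′ , j) are 1.  Hence a 5-hole is a
-- "pentagon": five rows r and five columns c such that, for all a and b, the
-- entries (r a , c b) and (r b , c a) are both 1 exactly when a and b are equal
-- or neighbours on the 5-cycle.  The 5 × 5 matrix X (r a) (c b) is then known
-- except on the five chords, where the two crossing entries are 00, 10 or 01.
-- Each of these 3⁵ matrices contains one of the four patterns, which a finite
-- search confirms.  As the patterns have no repeated rows or columns, it does
-- not matter whether the chosen rows or columns of X coincide.  Conversely, each
-- pattern contains a pentagon.

module Submission where

open import Defs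
open import Data.Nat using (ℕ)
open import Data.Sum using (_⊎_)
open import Function.Bundles using (_⇔_)

open import Data.Bool using (Bool; true; false; _∧_)
import Data.Bool.Properties as Bool
open import Data.Fin using (Fin)
open import Data.Fin.Patterns using (0F; 1F; 2F; 3F; 4F)
open import Data.Fin.Properties using (_≟_; all?; any?)
open import Data.Fin.Subset using (⁅_⁆; _∪_; _∈_)
open import Data.Fin.Subset.Properties using (x∈p∪q⁺; x∈p∪q⁻; x∈⁅x⁆; x∈⁅y⁆⇒x≡y)
import Data.Nat as ℕ
open import Data.Product using (_×_; _,_; ∃; ∃-syntax; proj₁; proj₂; uncurry)
open import Data.Product.Properties using (,-injectiveˡ; ,-injectiveʳ)
open import Data.Sum as Sum using (inj₁; inj₂; [_,_]′)
open import Data.Vec using (Vec; []; _∷_; lookup)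
open import Function using (_∘_; flip; id)
open import Function.Bundles using (mk⇔; Equivalence)
open import Function.Definitions using (Injective)
open import Relation.Binary.PropositionalEquality
  using (_≡_; _≢_; refl; sym; trans; cong; cong₂)
open import Relation.Nullary using (Dec; does; yes; no; contradiction)
open import Relation.Nullary.Decidable
  using (map′; _⊎-dec_; _→-dec_; from-yes; decidable-stable; dec-true; dec-false)

private variable
  m n p q : ℕ

-- Common rectangles and crossing entries.

x∈⁅x⁆∪⁅y⁆ : (x y : Fin n) → x ∈ ⁅ x ⁆ ∪ ⁅ y ⁆
x∈⁅x⁆∪⁅y⁆ x y = x∈p∪q⁺ (inj₁ (x∈⁅x⁆ x))

y∈⁅x⁆∪⁅y⁆ : (x y : Fin n) → y ∈ ⁅ x ⁆ ∪ ⁅ y ⁆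
y∈⁅x⁆∪⁅y⁆ x y = x∈p∪q⁺ (inj₂ (x∈⁅x⁆ y))

z∈⁅x⁆∪⁅y⁆⁻ : {x y z : Fin n} → z ∈ ⁅ x ⁆ ∪ ⁅ y ⁆ → z ≡ x ⊎ z ≡ y
z∈⁅x⁆∪⁅y⁆⁻ = Sum.map (x∈⁅y⁆⇒x≡y _) (x∈⁅y⁆⇒x≡y _) ∘ x∈p∪q⁻ _ _

adjacent⇒crossing : (X : BinMatrix m n) {i i′ : Fin m} {j j′ : Fin n} →
  Adjacent X (i , j) (i′ , j′) → X i j′ ∧ X i′ j ≡ true
adjacent⇒crossing X (_ , I , J , rect , (i∈I , j∈J) , (i′∈I , j′∈J)) =
  cong₂ _∧_ (rect _ _ i∈I j′∈J) (rect _ _ i′∈I j∈J)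

crossing⇒adjacent : (X : BinMatrix m n) {i i′ : Fin m} {j j′ : Fin n} →
  (i , j) ≢ (i′ , j′) → InSupp X (i , j) → InSupp X (i′ , j′) →
  X i j′ ∧ X i′ j ≡ true → Adjacent X (i , j) (i′ , j′)
crossing⇒adjacent X {i} {i′} {j} {j′} distinct ij i′j′ crossing =
  distinct , ⁅ i ⁆ ∪ ⁅ i′ ⁆ , ⁅ j ⁆ ∪ ⁅ j′ ⁆ , rect ,
  (x∈⁅x⁆∪⁅y⁆ i i′ , x∈⁅x⁆∪⁅y⁆ j j′) , (y∈⁅x⁆∪⁅y⁆ i i′ , y∈⁅x⁆∪⁅y⁆ j j′)
  where
  rect : IsRectangle X (⁅ i ⁆ ∪ ⁅ i′ ⁆) (⁅ j ⁆ ∪ ⁅ j′ ⁆)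
  rect _ _ k∈ l∈ with z∈⁅x⁆∪⁅y⁆⁻ k∈ | z∈⁅x⁆∪⁅y⁆⁻ l∈
  ... | inj₁ refl | inj₁ refl = ij
  ... | inj₁ refl | inj₂ refl = Bool.∧-conicalˡ _ _ crossing
  ... | inj₂ refl | inj₁ refl = Bool.∧-conicalʳ _ _ crossing
  ... | inj₂ refl | inj₂ refl = i′j′

-- Holes as pentagons.

Near : Fin 5 → Fin 5 → Set
Near a b = a ≡ b ⊎ Consecutive5 a b

near? : ∀ a b → Dec (Near a b)
near? a b = a ≟ b ⊎-dec (_ ℕ.≟ _ ⊎-dec _ ℕ.≟ _)

near : Fin 5 → Fin 5 → Bool
near a b = does (near? a b)

near⇒Near : ∀ {a b} → near a b ≡ true → Near a b
near⇒Near {a} {b} eq = decidable-stable (near? a b) λ ¬ab →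
  Bool.not-¬ eq (dec-false (near? a b) ¬ab)

-- The closed neighbourhoods of the 5-cycle are pairwise different. Hence the vertices of a pentagon
-- are distinct: equal vertices would have equal crossing products with every third one.
near-injective : ∀ a b → (∀ e → near a e ≡ near b e) → a ≡ b
near-injective = from-yes (all? λ a → all? λ b →
  (all? λ e → near a e Bool.≟ near b e) →-dec a ≟ b)

-- One Boolean equation covers the support (`a ≡ b`), the edges and the non-edges.
IsPentagon : BinMatrix m n → (Fin 5 → Fin m) → (Fin 5 → Fin n) → Set
IsPentagon X r c = ∀ a b → X (r a) (c b) ∧ X (r b) (c a) ≡ near a b

isPentagon? : (X : BinMatrix m n) → ∀ r c → Dec (IsPentagon X r c)
isPentagon? X r c = all? λ a → all? λ b → _ Bool.≟ near a b

HasPentagon : BinMatrix m n → Set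
HasPentagon X = ∃[ r ] ∃[ c ] IsPentagon X r c

hole⇒pentagon : (X : BinMatrix m n) → HasHole5 X → HasPentagon X
hole⇒pentagon X (v , injective , supp , adj⇔) =
  proj₁ ∘ v , proj₂ ∘ v , λ a b → crossing a b (near? a b)
  where
  -- With the decision as an argument, matching on it makes `does ab?` compute.
  crossing : ∀ a b (ab? : Dec (Near a b)) →
    X (proj₁ (v a)) (proj₂ (v b)) ∧ X (proj₁ (v b)) (proj₂ (v a)) ≡ does ab?
  crossing a b (yes (inj₁ refl)) = cong₂ _∧_ (supp a) (supp a)
  -- `adj⇔` speaks of distinct indices only; the impossible case `a ≡ b` is closed by the support
  -- instead of being refuted.
  crossing a b (yes (inj₂ ab)) with a ≟ b
  ... | yes refl = cong₂ _∧_ (supp a) (supp a)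
  ... | no a≢b = adjacent⇒crossing X (Equivalence.from (adj⇔ a b a≢b) ab)
  crossing a b (no ¬ab) = Bool.¬-not λ eq → ¬ab (inj₂ (Equivalence.to (adj⇔ a b (¬ab ∘ inj₁))
    (crossing⇒adjacent X (¬ab ∘ inj₁ ∘ injective) (supp a) (supp b) eq)))

pentagon⇒hole : (X : BinMatrix m n) → HasPentagon X → HasHole5 X
pentagon⇒hole X (r , c , pentagon) = v , injective , supp , λ a b a≢b →
  mk⇔
    (λ adj → [ flip contradiction a≢b , id ]′
      (near⇒Near (trans (sym (pentagon a b)) (adjacent⇒crossing X adj))))
    (λ ab → crossing⇒adjacent X (a≢b ∘ injective) (supp a) (supp b)
      (trans (pentagon a b) (dec-true (near? a b) (inj₂ ab))))
  where
  v : Fin 5 → Pos _ _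
  v a = r a , c a

  supp : ∀ a → InSupp X (v a)
  supp a = Bool.∧-conicalˡ _ _ (trans (pentagon a a) (dec-true (near? a a) (inj₁ refl)))

  injective : Injective _≡_ _≡_ v
  injective {a} {b} va≡vb = near-injective a b λ e → trans (sym (pentagon a e))
    (trans (cong₂ (λ i j → X i (c e) ∧ X (r e) j) (,-injectiveˡ va≡vb) (,-injectiveʳ va≡vb))
      (pentagon b e))

-- Pentagons in the patterns.

submatrix-pentagon : (X : BinMatrix m n) (M : BinMatrix p q) →
  HasPentagon M → HasSubmatrix X M → HasPentagon X
submatrix-pentagon X M (r , c , pentagon) (r′ , c′ , _ , _ , eq) =
  r′ ∘ r , c′ ∘ c , λ a b → trans (cong₂ _∧_ (eq _ _) (eq _ _)) (pentagon a b)

-- Transposition swaps the two crossing entries.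
pentagon-transpose : (X : BinMatrix m n) → HasPentagon X → HasPentagon (transpose X)
pentagon-transpose X (r , c , pentagon) =
  c , r , λ a b → trans (Bool.∧-comm (X (r b) (c a)) _) (pentagon a b)

-- Vertices 2 and 3 share a row, vertices 4 and 0 a column.
pentagon-D4 : HasPentagon D4
pentagon-D4 = r , c , from-yes (isPentagon? D4 r c)
  where
  r = lookup (0F ∷ 1F ∷ 2F ∷ 2F ∷ 3F ∷ [])
  c = lookup (2F ∷ 1F ∷ 0F ∷ 3F ∷ 2F ∷ [])

pentagon-H3 : HasPentagon H3
pentagon-H3 = r , c , from-yes (isPentagon? H3 r c)
  where
  r = lookup (0F ∷ 1F ∷ 1F ∷ 2F ∷ 2F ∷ [])
  c = lookup (0F ∷ 2F ∷ 3F ∷ 3F ∷ 1F ∷ [])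

pentagon-K5 : HasPentagon K5
pentagon-K5 = r , c , from-yes (isPentagon? K5 r c)
  where
  r = lookup (0F ∷ 1F ∷ 2F ∷ 3F ∷ 4F ∷ [])
  -- Shifting the columns by one turns the offsets 0, 1, 2 into -1, 0, 1, so the matrix becomes
  -- `near` itself.
  c = lookup (1F ∷ 2F ∷ 3F ∷ 4F ∷ 0F ∷ [])

-- Searching for the patterns.

RowsDistinct : BinMatrix m n → Set
RowsDistinct X = ∀ i i′ → (∀ j → X i j ≡ X i′ j) → i ≡ i′

rowsDistinct? : (X : BinMatrix m n) → Dec (RowsDistinct X)
rowsDistinct? X = all? λ i → all? λ i′ → (all? λ j → X i j Bool.≟ X i′ j) →-dec i ≟ i′

rows-H3 : RowsDistinct H3
rows-H3 = from-yes (rowsDistinct? H3)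

cols-H3 : RowsDistinct (transpose H3)
cols-H3 = from-yes (rowsDistinct? (transpose H3))

-- Choosing columns one at a time keeps the search for an occurrence small.
Occurs : BinMatrix m n → BinMatrix p q → Set
Occurs {m} {n} {p} X M = ∃ λ (r : Vec (Fin m) p) → ∀ j → ∃ λ c → ∀ i → X (lookup r i) c ≡ M i j

anyVec? : {P : Vec (Fin n) p → Set} → (∀ v → Dec (P v)) → Dec (∃ P)
anyVec? {p = ℕ.zero} P? = map′ ([] ,_) (λ { ([] , x) → x }) (P? [])
anyVec? {p = ℕ.suc _} P? =
  map′ (λ (x , xs , y) → x ∷ xs , y) (λ { (x ∷ xs , y) → x , xs , y })
    (any? λ x → anyVec? λ xs → P? (x ∷ xs))

occurs? : (X : BinMatrix m n) (M : BinMatrix p q) → Dec (Occurs X M)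
occurs? X M = anyVec? λ r → all? λ j → any? λ c → all? λ i → _ Bool.≟ M i j

submatrix : (X : BinMatrix m n) {M : BinMatrix p q} →
  RowsDistinct M → RowsDistinct (transpose M) → ∀ r c →
  (∀ i j → X (r i) (c j) ≡ M i j) → HasSubmatrix X M
submatrix X rows cols r c eq =
  r , c ,
  (λ {i} {i′} ri≡ri′ → rows i i′ λ j →
    trans (sym (eq i j)) (trans (cong (flip X (c j)) ri≡ri′) (eq i′ j))) ,
  (λ {j} {j′} cj≡cj′ → cols j j′ λ i →
    trans (sym (eq i j)) (trans (cong (X (r i)) cj≡cj′) (eq i j′))) ,
  eq

-- Patterns with fewer rows come first: the most expensive search, for `K5`, runs only when the
-- others fail.
OccursPattern : BinMatrix m n → Set
OccursPattern X = Occurs X H3 ⊎ Occurs X (transpose H3) ⊎ Occurs X D4 ⊎ Occurs X K5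

occursPattern? : (X : BinMatrix m n) → Dec (OccursPattern X)
occursPattern? X = occurs? X H3 ⊎-dec occurs? X (transpose H3) ⊎-dec occurs? X D4 ⊎-dec occurs? X K5

-- The k-th argument holds the entries (k , k + 2) and (k + 2 , k).
chordMatrix : (q₀ q₁ q₂ q₃ q₄ : Bool × Bool) → BinMatrix 5 5
chordMatrix (x₀ , y₀) (x₁ , y₁) (x₂ , y₂) (x₃ , y₃) (x₄ , y₄) = fromRows
  ( (true ∷ true ∷ x₀   ∷ y₃   ∷ true ∷ [])
  ∷ (true ∷ true ∷ true ∷ x₁   ∷ y₄   ∷ [])
  ∷ (y₀   ∷ true ∷ true ∷ true ∷ x₂   ∷ [])
  ∷ (x₃   ∷ y₁   ∷ true ∷ true ∷ true ∷ [])
  ∷ (true ∷ x₄   ∷ y₂   ∷ true ∷ true ∷ [])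
  ∷ [])

-- The three states of a non-edge, indexed by `Fin 3` so that `all?` can enumerate them.
orientation : Fin 3 → Bool × Bool
orientation 0F = false , false
orientation 1F = true , false
orientation 2F = false , true

oriented : ∀ q → uncurry _∧_ q ≡ false → ∃ λ k → q ≡ orientation k
oriented (false , false) _ = 0F , refl
oriented (true , false) _ = 1F , refl
oriented (false , true) _ = 2F , refl

oriented-occursPattern : ∀ k₀ k₁ k₂ k₃ k₄ → OccursPattern
  (chordMatrix (orientation k₀) (orientation k₁) (orientation k₂) (orientation k₃) (orientation k₄))
oriented-occursPattern = from-yes
  (all? λ k₀ → all? λ k₁ → all? λ k₂ → all? λ k₃ → all? λ k₄ → occursPattern?
    (chordMatrix (orientation k₀) (orientation k₁) (orientation k₂) (orientation k₃) (orientation k₄)))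

chordMatrix-occursPattern : ∀ q₀ q₁ q₂ q₃ q₄ →
  uncurry _∧_ q₀ ≡ false → uncurry _∧_ q₁ ≡ false → uncurry _∧_ q₂ ≡ false →
  uncurry _∧_ q₃ ≡ false → uncurry _∧_ q₄ ≡ false →
  OccursPattern (chordMatrix q₀ q₁ q₂ q₃ q₄)
chordMatrix-occursPattern q₀ q₁ q₂ q₃ q₄ h₀ h₁ h₂ h₃ h₄
  with oriented q₀ h₀ | oriented q₁ h₁ | oriented q₂ h₂ | oriented q₃ h₃ | oriented q₄ h₄
... | k₀ , refl | k₁ , refl | k₂ , refl | k₃ , refl | k₄ , refl =
  oriented-occursPattern k₀ k₁ k₂ k₃ k₄

module _ (X : BinMatrix m n) (r : Fin 5 → Fin m) (c : Fin 5 → Fin n)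
         (pentagon : IsPentagon X r c) where

  chord : Fin 5 → Fin 5 → Bool × Bool
  chord a b = X (r a) (c b) , X (r b) (c a)

  chords : BinMatrix 5 5
  -- Indices are modulo 5, so the last two chords wrap around to 0 and 1.
  chords = chordMatrix (chord 0F 2F) (chord 1F 3F) (chord 2F 4F) (chord 3F 0F) (chord 4F 1F)

  side : ∀ a b → near a b ≡ true → X (r a) (c b) ≡ true
  side a b ab = Bool.∧-conicalˡ _ _ (trans (pentagon a b) ab)

  -- Chord entries are copied from `X`; all others are forced to be 1. The cases are spelled out
  -- because `chords` reduces only at concrete indices.
  pentagon-entry : ∀ a b → X (r a) (c b) ≡ chords a b
  pentagon-entry 0F 0F = side 0F 0F refl
  pentagon-entry 0F 1F = side 0F 1F refl
  pentagon-entry 0F 2F = refl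
  pentagon-entry 0F 3F = refl
  pentagon-entry 0F 4F = side 0F 4F refl
  pentagon-entry 1F 0F = side 1F 0F refl
  pentagon-entry 1F 1F = side 1F 1F refl
  pentagon-entry 1F 2F = side 1F 2F refl
  pentagon-entry 1F 3F = refl
  pentagon-entry 1F 4F = refl
  pentagon-entry 2F 0F = refl
  pentagon-entry 2F 1F = side 2F 1F refl
  pentagon-entry 2F 2F = side 2F 2F refl
  pentagon-entry 2F 3F = side 2F 3F refl
  pentagon-entry 2F 4F = refl
  pentagon-entry 3F 0F = refl
  pentagon-entry 3F 1F = refl
  pentagon-entry 3F 2F = side 3F 2F refl
  pentagon-entry 3F 3F = side 3F 3F refl
  pentagon-entry 3F 4F = side 3F 4F refl
  pentagon-entry 4F 0F = side 4F 0F refl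
  pentagon-entry 4F 1F = refl
  pentagon-entry 4F 2F = refl
  pentagon-entry 4F 3F = side 4F 3F refl
  pentagon-entry 4F 4F = side 4F 4F refl

  occurs⇒submatrix : (M : BinMatrix p q) → RowsDistinct M → RowsDistinct (transpose M) →
    Occurs chords M → HasSubmatrix X M
  occurs⇒submatrix M rows cols (r′ , columns) =
    submatrix X rows cols (r ∘ lookup r′) (c ∘ proj₁ ∘ columns)
      λ i j → trans (pentagon-entry (lookup r′ i) (proj₁ (columns j))) (proj₂ (columns j) i)

  pentagon⇒submatrix :
    HasSubmatrix X D4 ⊎ HasSubmatrix X H3 ⊎ HasSubmatrix X (transpose H3) ⊎ HasSubmatrix X K5
  pentagon⇒submatrix
    -- On each chord `near` evaluates to `false`, so the pentagon equations are the required
    -- hypotheses.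
    with chordMatrix-occursPattern (chord 0F 2F) (chord 1F 3F) (chord 2F 4F) (chord 3F 0F) (chord 4F 1F)
      (pentagon 0F 2F) (pentagon 1F 3F) (pentagon 2F 4F) (pentagon 3F 0F) (pentagon 4F 1F)
  ... | inj₁ h3 = inj₂ (inj₁ (occurs⇒submatrix H3 rows-H3 cols-H3 h3))
  -- Transposing twice gives back `H3` definitionally, so the two facts about `H3` trade places.
  ... | inj₂ (inj₁ h3ᵀ) = inj₂ (inj₂ (inj₁ (occurs⇒submatrix (transpose H3) cols-H3 rows-H3 h3ᵀ)))
  ... | inj₂ (inj₂ (inj₁ d4)) = inj₁ (occurs⇒submatrix D4
    (from-yes (rowsDistinct? D4)) (from-yes (rowsDistinct? (transpose D4))) d4)
  ... | inj₂ (inj₂ (inj₂ k5)) = inj₂ (inj₂ (inj₂ (occurs⇒submatrix K5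
    (from-yes (rowsDistinct? K5)) (from-yes (rowsDistinct? (transpose K5))) k5)))

theorem2 : ∀ {m n : ℕ} (X : BinMatrix m n) →
    HasHole5 X ⇔
    (HasSubmatrix X D4 ⊎ HasSubmatrix X H3 ⊎ HasSubmatrix X (transpose H3) ⊎ HasSubmatrix X K5)
theorem2 X = mk⇔
  (λ hole → let (r , c , pentagon) = hole⇒pentagon X hole in pentagon⇒submatrix X r c pentagon)
  (pentagon⇒hole X ∘
    [ submatrix-pentagon X D4 pentagon-D4
    , [ submatrix-pentagon X H3 pentagon-H3
    , [ submatrix-pentagon X (transpose H3) (pentagon-transpose H3 pentagon-H3)
    , submatrix-pentagon X K5 pentagon-K5 ]′ ]′ ]′)
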